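{- For every integer $n\ge 0$, the number $N_{ST}(G_n)$ of spanning trees of the Farey graph $G_n$ is $$N_{ST}(G_n)=(2^{n+1}-1)\prod_{i=2}^{n}(2^i-1)^{2^{n-i}},$$ where an empty product equals $1$.
   Context: The Farey graphs $G_n$ ($n\ge 0$), each with two distinguished ("special") vertices $X_n,Y_n$, are defined recursively. $G_0$ is a single edge joining its two special vertices $X_0$ and $Y_0$. For $n\ge 1$, take two disjoint copies $G_{n-1}^1,G_{n-1}^2$ of $G_{n-1}$, with special vertices $X_{n-1}^i,Y_{n-1}^i$ ($i=1,2$); identify $Y_{n-1}^1$ with $X_{n-1}^2$ into one vertex, and add a new edge $e_n$ joining $X_{n-1}^1$ and $Y_{n-1}^2$. The result is $G_n$, with special vertices $X_n=X_{n-1}^1$ and $Y_n=Y_{n-1}^2$. It has $2^n+1$ vertices and $2^{n+1}-1$ edges. -}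

module Defs where

open import Data.Fin using (Fin)
open import Data.Fin.Subset as Subset using (Subset)
open import Data.List using (List; []; _∷_; length; product; applyUpTo)
open import Data.List.Membership.Propositional using (_∈_)
open import Data.List.Relation.Unary.Unique.Propositional using (Unique)
open import Data.Nat using (ℕ; zero; suc; _+_; _∸_)
open import Data.Product using (_×_; _,_; ∃-syntax) renaming (map to map×)
open import Data.Sum using (_⊎_)
open import Data.Vec as Vec using (Vec; lookup)
open import Function.Bundles using (_⇔_)
open import Relation.Binary.PropositionalEquality using (_≡_; _≢_)
open import Relation.Nullary using (¬_)

-- Undirected multigraphs with edge set Fin numEdges; the order of the two ends
-- of an edge carries no meaning (see Joins).
record Graph : Set₁ where
  field
    Vertex   : Set
    numEdges : ℕ
    ends     : Vec (Vertex × Vertex) numEdges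

  Edge : Set
  Edge = Fin numEdges

  Joins : Edge → Vertex → Vertex → Set
  Joins e u v = lookup ends e ≡ (u , v) ⊎ lookup ends e ≡ (v , u)

-- T ⊆ E(G) stands for the spanning subgraph (V(G), T).
module _ (G : Graph) where
  open Graph G

  data Walk (T : Subset numEdges) : Vertex → Vertex → Set where
    stop : ∀ {u} → Walk T u u
    step : ∀ {u v w} (e : Edge) → e Subset.∈ T → Joins e u v → Walk T v w → Walk T u w

  module _ {T : Subset numEdges} where

    walkEdges : ∀ {u v} → Walk T u v → List Edge
    walkEdges stop           = []
    walkEdges (step e _ _ w) = e ∷ walkEdges w

    -- The final vertex is omitted, so that on a closed walk the base vertex is
    -- listed only once.
    walkVertices : ∀ {u v} → Walk T u v → List Vertex
    walkVertices stop                   = []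
    walkVertices (step {u = u} _ _ _ w) = u ∷ walkVertices w

    -- Distinctness of edges matters only for length 2: it rules out traversing
    -- one edge back and forth.  Loops and pairs of parallel edges are cycles.
    IsCycle : ∀ {u} → Walk T u u → Set
    IsCycle w = walkEdges w ≢ [] × Unique (walkEdges w) × Unique (walkVertices w)

  Connected : Subset numEdges → Set
  Connected T = ∀ u v → Walk T u v

  Acyclic : Subset numEdges → Set
  Acyclic T = ∀ {u} (w : Walk T u u) → ¬ IsCycle w

  IsSpanningTree : Subset numEdges → Set
  IsSpanningTree T = Connected T × Acyclic T

-- Exactly k elements of A satisfy P.
Count : {A : Set} → (A → Set) → ℕ → Set
Count {A} P k = ∃[ xs ] Unique xs × (∀ (x : A) → x ∈ xs ⇔ P x) × length xs ≡ k

NumSpanningTrees : Graph → ℕ → Set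
NumSpanningTrees G k = Count (IsSpanningTree G) k

-- Vertices of the Farey graphs other than the two special ones: `mid` is the
-- vertex obtained by identifying Y of the first copy with X of the second.
data Inner : ℕ → Set where
  mid    : ∀ {n} → Inner (suc n)
  first  : ∀ {n} → Inner n → Inner (suc n)
  second : ∀ {n} → Inner n → Inner (suc n)

data FareyVertex (n : ℕ) : Set where
  X     : FareyVertex n
  Y     : FareyVertex n
  inner : Inner n → FareyVertex n

-- The maps of the two copies of G_n into G_{n+1}; their images meet only in
-- copy₁ Y = copy₂ X.
copy₁ : ∀ {n} → FareyVertex n → FareyVertex (suc n)
copy₁ X         = X
copy₁ Y         = inner mid
copy₁ (inner v) = inner (first v)

copy₂ : ∀ {n} → FareyVertex n → FareyVertex (suc n)
copy₂ X         = inner mid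
copy₂ Y         = Y
copy₂ (inner v) = inner (second v)

fareySize : ℕ → ℕ
fareySize zero    = 1
fareySize (suc n) = suc (fareySize n + fareySize n)

fareyEdges : ∀ n → Vec (FareyVertex n × FareyVertex n) (fareySize n)
fareyEdges zero    = Vec.[ X , Y ]
fareyEdges (suc n) =
  (X , Y) Vec.∷ (Vec.map (map× copy₁ copy₁) (fareyEdges n)
                 Vec.++ Vec.map (map× copy₂ copy₂) (fareyEdges n))

Farey : ℕ → Graph
Farey n = record
  { Vertex   = FareyVertex n
  ; numEdges = fareySize n
  ; ends     = fareyEdges n
  }

-- ∏ a b f = f a * f (a + 1) * … * f b, which is 1 when b < a.
∏ : ℕ → ℕ → (ℕ → ℕ) → ℕ
∏ a b f = product (applyUpTo (λ j → f (a + j)) (suc b ∸ a))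

{-# OPTIONS --safe #-}

-- Deciding whether the new edge is kept, a spanning tree of G_{n+1} is either
-- a spanning tree in each copy, or the new edge together with a spanning tree
-- in one copy and, in the other, a spanning forest with two components that
-- separate X from Y.  The latter pair without the new edge is a separating
-- forest of G_{n+1}.  Hence the numbers t of trees and f of separating forests
-- satisfy t' = t² + 2tf and f' = 2tf, with t = f = 1 at n = 0.  With P the
-- product of the theorem, t = (2^(n+1) ∸ 1) P and f = 2^n P.
--
-- Two-colourings of the vertices certify all negative facts: T is acyclic if
-- for each edge e of T some colouring is constant along T ∖ e but not on e, and
-- disconnected if some non-constant colouring is constant along T.
module Submission where

open import Defs
open import Data.Bool using (Bool; true; false)
open import Data.Empty using (⊥-elim)
open import Data.Fin using (Fin; zero; suc; _↑ˡ_; _↑ʳ_; splitAt; join)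
open import Data.Fin.Properties using (↑ˡ-injective; ↑ʳ-injective; suc-injective; join-splitAt)
open import Data.Fin.Subset using (Subset; Side; inside; outside; _∈_)
open import Data.List as List using (List; []; _∷_; cartesianProductWith; length; applyUpTo)
open import Data.List.Membership.Propositional as List∈ using (_∉_)
open import Data.List.Membership.Propositional.Properties
  using (∈-++⁺ˡ; ∈-++⁺ʳ; ∈-++⁻; ∈-map⁺; ∈-map⁻; ∈-cartesianProductWith⁺; ∈-cartesianProductWith⁻)
open import Data.List.Properties using (length-++; length-map; applyUpTo-∷ʳ)
open import Data.List.Relation.Unary.All using (All; []; _∷_)
import Data.List.Relation.Unary.All.Properties as All
open import Data.List.Relation.Unary.AllPairs using ([]; _∷_)
open import Data.List.Relation.Unary.Any using (here; there)
open import Data.List.Relation.Unary.Unique.Propositional using (Unique)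
import Data.List.Relation.Unary.Unique.Propositional.Properties as Unique
open import Data.Nat using (ℕ; zero; suc; _+_; _*_; _∸_; _^_; _<_; z≤n; s≤s)
open import Data.Nat.ListAction using (product)
open import Data.Nat.ListAction.Properties using (product-++)
open import Data.Nat.Properties
  using (+-comm; +-identityʳ; *-identityʳ; ^-distribˡ-+-*; n∸n≡0; +-∸-assoc; m^n>0)
open import Data.Nat.Tactic.RingSolver using (solve-∀)
open import Data.Product using (_×_; _,_; ∃; ∃₂; proj₁; proj₂; -,_) renaming (map to map×)
open import Data.Sum as Sum using (_⊎_; inj₁; inj₂; [_,_]′)
open import Data.Vec as Vec using (lookup; here; there; _[_]≔_)
open import Data.Vec.Properties
  using ([]=⇒lookup; lookup⇒[]=; lookup-++ˡ; lookup-++ʳ; lookup-map; lookup∘update′;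
         []≔-++-↑ˡ; []≔-++-↑ʳ; ++-injective; ∷-injectiveʳ)
open import Function using (_∘_; mk⇔; Injective)
open import Relation.Binary.PropositionalEquality
  using (_≡_; _≢_; refl; sym; trans; cong; cong₂; subst; ≢-sym; module ≡-Reasoning)
open import Relation.Nullary using (¬_)

-- Walks and colourings in a graph

module _ {G : Graph} where
  open Graph G

  module _ {T : Subset numEdges} where

    infixr 5 _▷_
    _▷_ : ∀ {u v w} → Walk G T u v → Walk G T v w → Walk G T u w
    stop          ▷ q = q
    step e e∈ j p ▷ q = step e e∈ j (p ▷ q)

    reverse : ∀ {u v} → Walk G T u v → Walk G T v u
    reverse stop            = stop
    reverse (step e e∈ j p) = reverse p ▷ step e e∈ (Sum.swap j) stop

    walkEdges-▷ : ∀ {u v w} (p : Walk G T u v) (q : Walk G T v w) →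
                  walkEdges G (p ▷ q) ≡ walkEdges G p List.++ walkEdges G q
    walkEdges-▷ stop           q = refl
    walkEdges-▷ (step e _ _ p) q = cong (e ∷_) (walkEdges-▷ p q)

    walkVertices-▷ : ∀ {u v w} (p : Walk G T u v) (q : Walk G T v w) →
                     walkVertices G (p ▷ q) ≡ walkVertices G p List.++ walkVertices G q
    walkVertices-▷ stop                   q = refl
    walkVertices-▷ (step {u = u} _ _ _ p) q = cong (u ∷_) (walkVertices-▷ p q)

    avoid : ∀ {e u v} (p : Walk G T u v) → All (e ≢_) (walkEdges G p) →
            Walk G (T [ e ]≔ outside) u v
    avoid stop             []           = stop
    avoid (step e′ e∈ j p) (e≢e′ ∷ e≢p) =
      step e′ (lookup⇒[]= e′ _ (trans (lookup∘update′ (≢-sym e≢e′) T outside) ([]=⇒lookup e∈)))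
           j (avoid p e≢p)

  Cyclic : Subset numEdges → Set
  Cyclic T = ∃ λ u → ∃ λ (p : Walk G T u u) → IsCycle G p

  Monochromatic : Subset numEdges → (Vertex → Bool) → Set
  Monochromatic T c = ∀ {e} → e ∈ T → c (proj₁ (lookup ends e)) ≡ c (proj₂ (lookup ends e))

  Splits : Edge → (Vertex → Bool) → Set
  Splits e c = c (proj₁ (lookup ends e)) ≢ c (proj₂ (lookup ends e))

  monochromatic-joins : ∀ {T c e u v} → Monochromatic T c → e ∈ T → Joins e u v → c u ≡ c v
  monochromatic-joins {c = c} mono e∈ (inj₁ j) =
    subst (λ p → c (proj₁ p) ≡ c (proj₂ p)) j (mono e∈)
  monochromatic-joins {c = c} mono e∈ (inj₂ j) =
    sym (subst (λ p → c (proj₁ p) ≡ c (proj₂ p)) j (mono e∈))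

  monochromatic-walk : ∀ {T c u v} → Monochromatic T c → Walk G T u v → c u ≡ c v
  monochromatic-walk mono stop            = refl
  monochromatic-walk {T} {c} mono (step e e∈ j p) =
    trans (monochromatic-joins {T} {c} mono e∈ j) (monochromatic-walk {T} {c} mono p)

  splits-joins : ∀ {c e u v} → Splits e c → Joins e u v → c u ≢ c v
  splits-joins {c} split (inj₁ j) eq =
    split (subst (λ p → c (proj₁ p) ≡ c (proj₂ p)) (sym j) eq)
  splits-joins {c} split (inj₂ j) eq =
    split (subst (λ p → c (proj₁ p) ≡ c (proj₂ p)) (sym j) (sym eq))

  -- The first edge `e` of a cycle is not repeated, so the rest of the cycle is a walk between the
  -- ends of `e` that avoids `e`. The colouring is constant along that walk, yet it splits `e`.
  bridges⇒acyclic : ∀ {T} →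
    (∀ e → e ∈ T → ∃ λ c → Monochromatic (T [ e ]≔ outside) c × Splits e c) → Acyclic G T
  bridges⇒acyclic bridges stop (nonempty , _) = nonempty refl
  bridges⇒acyclic bridges (step e e∈ j p) (_ , e≢p ∷ _ , _)
    with c , mono , split ← bridges e e∈ =
    splits-joins {c} split j (sym (monochromatic-walk {c = c} mono (avoid p e≢p)))

  -- `walkVertices` omits the last vertex of a walk; `end∉` is what extends distinctness to the end.
  record SimplePath (T : Subset numEdges) (u v : Vertex) : Set where
    field
      walk           : Walk G T u v
      uniqueEdges    : Unique (walkEdges G walk)
      uniqueVertices : Unique (walkVertices G walk)
      end∉           : v ∉ walkVertices G walk

  -- The closing edge goes first: the cycle then lists `v` before the vertices of the path, and
  -- `end∉` is exactly the distinctness this requires.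
  closePath : ∀ {T u v e} (p : SimplePath T u v) → e ∈ T → Joins e v u →
              e ∉ walkEdges G (SimplePath.walk p) → Cyclic T
  closePath {e = e} p e∈ j e∉ =
    -, step e e∈ j walk
     , (λ ())
     , All.¬Any⇒All¬ _ e∉ ∷ uniqueEdges
     , All.¬Any⇒All¬ _ end∉ ∷ uniqueVertices
    where open SimplePath p

-- Embedded subgraphs

-- Membership is carried only from `S` to `T`, so walks, simple paths and cycles move forward;
-- negative facts are moved by gluing colourings instead.
record Embedding {G H : Graph} (S : Subset (Graph.numEdges G)) (T : Subset (Graph.numEdges H)) : Set where
  private
    module G = Graph G
    module H = Graph H
  field
    f      : G.Vertex → H.Vertex
    g      : G.Edge → H.Edge
    f-inj  : Injective _≡_ _≡_ f
    g-inj  : Injective _≡_ _≡_ g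
    g-ends : ∀ e → lookup H.ends (g e) ≡ map× f f (lookup G.ends e)
    g-∈    : ∀ {e} → e ∈ S → g e ∈ T

  map-joins : ∀ {e u v} → G.Joins e u v → H.Joins (g e) (f u) (f v)
  map-joins = Sum.map (λ j → trans (g-ends _) (cong (map× f f) j))
                      (λ j → trans (g-ends _) (cong (map× f f) j))

  mapWalk : ∀ {u v} → Walk G S u v → Walk H T (f u) (f v)
  mapWalk stop            = stop
  mapWalk (step e e∈ j p) = step (g e) (g-∈ e∈) (map-joins j) (mapWalk p)

  walkEdges-map : ∀ {u v} (p : Walk G S u v) →
                  walkEdges H (mapWalk p) ≡ List.map g (walkEdges G p)
  walkEdges-map stop           = refl
  walkEdges-map (step e _ _ p) = cong (g e ∷_) (walkEdges-map p)

  walkVertices-map : ∀ {u v} (p : Walk G S u v) →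
                     walkVertices H (mapWalk p) ≡ List.map f (walkVertices G p)
  walkVertices-map stop                   = refl
  walkVertices-map (step {u = u} _ _ _ p) = cong (f u ∷_) (walkVertices-map p)

  mapSimplePath : ∀ {u v} → SimplePath {G} S u v → SimplePath {H} T (f u) (f v)
  mapSimplePath {v = v} p = record
    { walk           = mapWalk walk
    ; uniqueEdges    = subst Unique (sym (walkEdges-map walk)) (Unique.map⁺ g-inj uniqueEdges)
    ; uniqueVertices = subst Unique (sym (walkVertices-map walk)) (Unique.map⁺ f-inj uniqueVertices)
    ; end∉           = λ v∈ → fv∉ (subst (f v List∈.∈_) (walkVertices-map walk) v∈)
    }
    where
    open SimplePath p
    fv∉ : f v ∉ List.map f (walkVertices G walk)
    fv∉ fv∈ with x , x∈ , eq ← ∈-map⁻ f fv∈ = end∉ (subst (List∈._∈ _) (sym (f-inj eq)) x∈)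

  mapCyclic : Cyclic {G} S → Cyclic {H} T
  mapCyclic (u , stop , nonempty , _) = ⊥-elim (nonempty refl)
  mapCyclic (u , p@(step _ _ _ _) , _ , uniqueE , uniqueV) =
    -, mapWalk p
     , (λ ())
     , subst Unique (sym (walkEdges-map p)) (Unique.map⁺ g-inj uniqueE)
     , subst Unique (sym (walkVertices-map p)) (Unique.map⁺ f-inj uniqueV)

-- The two copies of G_n in G_{n+1}

copy₁-injective : ∀ {n} → Injective _≡_ _≡_ (copy₁ {n})
copy₁-injective {x = X}       {X}       eq   = refl
copy₁-injective {x = Y}       {Y}       eq   = refl
copy₁-injective {x = inner _} {inner _} refl = refl

copy₂-injective : ∀ {n} → Injective _≡_ _≡_ (copy₂ {n})
copy₂-injective {x = X}       {X}       eq   = refl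
copy₂-injective {x = Y}       {Y}       eq   = refl
copy₂-injective {x = inner _} {inner _} refl = refl

-- The copies overlap, so views are not unique: the shared vertex is both `copy₁ Y` and `copy₂ X`,
-- and `copyView` assigns it to the first copy.
data CopyView {n} : FareyVertex (suc n) → Set where
  first  : ∀ v → CopyView (copy₁ v)
  second : ∀ v → CopyView (copy₂ v)

copyView : ∀ {n} (v : FareyVertex (suc n)) → CopyView v
copyView X                  = first X
copyView Y                  = second Y
copyView (inner mid)        = first Y
copyView (inner (first v))  = first (inner v)
copyView (inner (second v)) = second (inner v)

edge₁ : ∀ n → Fin (fareySize n) → Fin (fareySize (suc n))
edge₁ n i = suc (i ↑ˡ fareySize n)

edge₂ : ∀ n → Fin (fareySize n) → Fin (fareySize (suc n))
edge₂ n i = suc (fareySize n ↑ʳ i)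

data EdgeView n : Fin (fareySize (suc n)) → Set where
  base   : EdgeView n zero
  first  : ∀ i → EdgeView n (edge₁ n i)
  second : ∀ i → EdgeView n (edge₂ n i)

edgeView : ∀ n e → EdgeView n e
edgeView n zero    = base
edgeView n (suc i) =
  subst (EdgeView n ∘ suc) (join-splitAt (fareySize n) (fareySize n) i) (view (splitAt (fareySize n) i))
  where
  view : ∀ s → EdgeView n (suc (join (fareySize n) (fareySize n) s))
  view (inj₁ i) = first i
  view (inj₂ i) = second i

edge₁≢edge₂ : ∀ n i j → edge₁ n i ≢ edge₂ n j
edge₁≢edge₂ n i j eq = ↑ˡ≢↑ʳ i j (suc-injective eq)
  where
  ↑ˡ≢↑ʳ : ∀ {m k} (i : Fin m) (j : Fin k) → i ↑ˡ k ≢ m ↑ʳ j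
  ↑ˡ≢↑ʳ (suc i) j eq = ↑ˡ≢↑ʳ i j (suc-injective eq)

ends-edge₁ : ∀ n i → lookup (fareyEdges (suc n)) (edge₁ n i) ≡ map× copy₁ copy₁ (lookup (fareyEdges n) i)
ends-edge₁ n i =
  trans (lookup-++ˡ (Vec.map (map× copy₁ copy₁) (fareyEdges n)) (Vec.map (map× copy₂ copy₂) (fareyEdges n)) i)
        (lookup-map i _ (fareyEdges n))

ends-edge₂ : ∀ n i → lookup (fareyEdges (suc n)) (edge₂ n i) ≡ map× copy₂ copy₂ (lookup (fareyEdges n) i)
ends-edge₂ n i =
  trans (lookup-++ʳ (Vec.map (map× copy₁ copy₁) (fareyEdges n)) (Vec.map (map× copy₂ copy₂) (fareyEdges n)) i)
        (lookup-map i _ (fareyEdges n))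

FareySubset : ℕ → Set
FareySubset n = Subset (fareySize n)

module _ {n : ℕ} {b : Side} (S T : FareySubset n) where

  ∈-edge₁⁺ : ∀ {i} → i ∈ S → edge₁ n i ∈ (b Vec.∷ (S Vec.++ T))
  ∈-edge₁⁺ {i} i∈ = there (lookup⇒[]= _ _ (trans (lookup-++ˡ S T i) ([]=⇒lookup i∈)))

  ∈-edge₁⁻ : ∀ {i} → edge₁ n i ∈ (b Vec.∷ (S Vec.++ T)) → i ∈ S
  ∈-edge₁⁻ {i} (there i∈) = lookup⇒[]= _ _ (trans (sym (lookup-++ˡ S T i)) ([]=⇒lookup i∈))

  ∈-edge₂⁺ : ∀ {i} → i ∈ T → edge₂ n i ∈ (b Vec.∷ (S Vec.++ T))
  ∈-edge₂⁺ {i} i∈ = there (lookup⇒[]= _ _ (trans (lookup-++ʳ S T i) ([]=⇒lookup i∈)))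

  ∈-edge₂⁻ : ∀ {i} → edge₂ n i ∈ (b Vec.∷ (S Vec.++ T)) → i ∈ T
  ∈-edge₂⁻ {i} (there i∈) = lookup⇒[]= _ _ (trans (sym (lookup-++ʳ S T i)) ([]=⇒lookup i∈))

  embed₁ : Embedding {Farey n} {Farey (suc n)} S (b Vec.∷ (S Vec.++ T))
  embed₁ = record
    { f      = copy₁
    ; g      = edge₁ n
    ; f-inj  = copy₁-injective
    ; g-inj  = ↑ˡ-injective _ _ _ ∘ suc-injective
    ; g-ends = ends-edge₁ n
    ; g-∈    = ∈-edge₁⁺
    }

  embed₂ : Embedding {Farey n} {Farey (suc n)} T (b Vec.∷ (S Vec.++ T))
  embed₂ = record
    { f      = copy₂
    ; g      = edge₂ n
    ; f-inj  = copy₂-injective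
    ; g-inj  = ↑ʳ-injective _ _ _ ∘ suc-injective
    ; g-ends = ends-edge₂ n
    ; g-∈    = ∈-edge₂⁺
    }

  module _ where
    open Embedding

    walk₁ : ∀ {u v} → Walk (Farey n) S u v →
            Walk (Farey (suc n)) (b Vec.∷ (S Vec.++ T)) (copy₁ u) (copy₁ v)
    walk₁ = mapWalk embed₁

    walk₂ : ∀ {u v} → Walk (Farey n) T u v →
            Walk (Farey (suc n)) (b Vec.∷ (S Vec.++ T)) (copy₂ u) (copy₂ v)
    walk₂ = mapWalk embed₂

    -- The copies meet only in the vertex where the first path ends, and its vertex list omits that
    -- end, so concatenation repeats nothing. Avoidance of edge `zero` is recorded so that the new
    -- edge can close the path to a cycle.
    joinPaths : SimplePath {Farey n} S X Y → SimplePath {Farey n} T X Y →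
                ∃ λ (p : SimplePath {Farey (suc n)} (b Vec.∷ (S Vec.++ T)) X Y) →
                  zero ∉ walkEdges (Farey (suc n)) (SimplePath.walk p)
    joinPaths p q = record
      { walk           = P.walk ▷ Q.walk
      ; uniqueEdges    = subst Unique (sym (walkEdges-▷ P.walk Q.walk))
                           (Unique.++⁺ P.uniqueEdges Q.uniqueEdges edgesDisjoint)
      ; uniqueVertices = subst Unique (sym (walkVertices-▷ P.walk Q.walk))
                           (Unique.++⁺ P.uniqueVertices Q.uniqueVertices verticesDisjoint)
      ; end∉           = λ Y∈ → Y∉ (subst (Y List∈.∈_) (walkVertices-▷ P.walk Q.walk) Y∈)
      } , λ 0∈ → 0∉ (subst (zero List∈.∈_) (walkEdges-▷ P.walk Q.walk) 0∈)
      where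
      module p = SimplePath p
      module q = SimplePath q
      module P = SimplePath (mapSimplePath embed₁ p)
      module Q = SimplePath (mapSimplePath embed₂ q)

      edges₁ : ∀ {e} → e List∈.∈ walkEdges _ P.walk → ∃ λ i → e ≡ edge₁ n i
      edges₁ e∈ with i , _ , eq ← ∈-map⁻ _ (subst (_ List∈.∈_) (walkEdges-map embed₁ p.walk) e∈) = i , eq

      edges₂ : ∀ {e} → e List∈.∈ walkEdges _ Q.walk → ∃ λ i → e ≡ edge₂ n i
      edges₂ e∈ with i , _ , eq ← ∈-map⁻ _ (subst (_ List∈.∈_) (walkEdges-map embed₂ q.walk) e∈) = i , eq

      vertices₁ : ∀ {v} → v List∈.∈ walkVertices _ P.walk → ∃ λ u → u ≢ Y × v ≡ copy₁ u
      vertices₁ v∈ with u , u∈ , eq ← ∈-map⁻ _ (subst (_ List∈.∈_) (walkVertices-map embed₁ p.walk) v∈) =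
        u , (λ { refl → p.end∉ u∈ }) , eq

      vertices₂ : ∀ {v} → v List∈.∈ walkVertices _ Q.walk → ∃ λ u → u ≢ Y × v ≡ copy₂ u
      vertices₂ v∈ with u , u∈ , eq ← ∈-map⁻ _ (subst (_ List∈.∈_) (walkVertices-map embed₂ q.walk) v∈) =
        u , (λ { refl → q.end∉ u∈ }) , eq

      edgesDisjoint : ∀ {e} → ¬ (e List∈.∈ walkEdges _ P.walk × e List∈.∈ walkEdges _ Q.walk)
      edgesDisjoint (e∈₁ , e∈₂) with i , refl ← edges₁ e∈₁ | j , eq ← edges₂ e∈₂ = edge₁≢edge₂ n i j eq

      copies-meet : ∀ (u v : FareyVertex n) → copy₁ u ≡ copy₂ v → u ≡ Y
      copies-meet X         X         ()
      copies-meet X         Y         ()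
      copies-meet X         (inner _) ()
      copies-meet Y         _         _  = refl
      copies-meet (inner _) X         ()
      copies-meet (inner _) Y         ()
      copies-meet (inner _) (inner _) ()

      verticesDisjoint : ∀ {v} → ¬ (v List∈.∈ walkVertices _ P.walk × v List∈.∈ walkVertices _ Q.walk)
      verticesDisjoint (v∈₁ , v∈₂) with u , u≢Y , refl ← vertices₁ v∈₁ | v , _ , eq ← vertices₂ v∈₂ =
        u≢Y (copies-meet u v eq)

      Y∉ : Y ∉ walkVertices _ P.walk List.++ walkVertices _ Q.walk
      Y∉ Y∈ with ∈-++⁻ (walkVertices _ P.walk) Y∈
      ... | inj₁ Y∈₁ with vertices₁ Y∈₁
      ...   | X       , _ , ()
      ...   | Y       , _ , ()
      ...   | inner _ , _ , ()
      Y∉ Y∈ | inj₂ Y∈₂ with u , u≢Y , eq ← vertices₂ Y∈₂ = u≢Y (copy₂-injective (sym eq))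

      0∉ : zero ∉ walkEdges _ P.walk List.++ walkEdges _ Q.walk
      0∉ 0∈ with ∈-++⁻ (walkEdges _ P.walk) 0∈
      ... | inj₁ 0∈₁ with () ← proj₂ (edges₁ 0∈₁)
      ... | inj₂ 0∈₂ with () ← proj₂ (edges₂ 0∈₂)

-- Colourings with prescribed values at X and Y

-- The colours at `X` and `Y` are indices because a copy meets the rest of the graph only there:
-- colourings of two copies glue once their indices at the shared vertex agree.
record Colouring {n} (T : FareySubset n) (a b : Bool) : Set where
  constructor colouring
  field
    colour        : FareyVertex n → Bool
    colour-X      : colour X ≡ a
    colour-Y      : colour Y ≡ b
    monochromatic : Monochromatic {Farey n} T colour

open Colouring

Bridge : ∀ {n} (T : FareySubset n) → Fin (fareySize n) → Bool → Bool → Set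
Bridge {n} T e a b = ∃ λ (κ : Colouring (T [ e ]≔ outside) a b) → Splits {Farey n} e (colour κ)

-- A certificate of disconnection that survives in the next graph: with `false` at both `X` and `Y`,
-- it tolerates an edge between them and extends to the other copy by the constant `false`.
Detached : ∀ {n} → FareySubset n → Set
Detached T = ∃ λ (κ : Colouring T false false) → ∃ λ z → colour κ z ≡ true

constant : ∀ {n} {T : FareySubset n} a → Colouring T a a
constant a = colouring (λ _ → a) refl refl (λ _ → refl)

module _ {A : Set} {n} (c d : FareyVertex n → A) where

  glue : FareyVertex (suc n) → A
  glue X                  = c X
  glue Y                  = d Y
  glue (inner mid)        = c Y
  glue (inner (first v))  = c (inner v)
  glue (inner (second v)) = d (inner v)

  glue-copy₁ : ∀ v → glue (copy₁ v) ≡ c v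
  glue-copy₁ X         = refl
  glue-copy₁ Y         = refl
  glue-copy₁ (inner _) = refl

  glue-copy₂ : c Y ≡ d X → ∀ v → glue (copy₂ v) ≡ d v
  glue-copy₂ eq X         = eq
  glue-copy₂ eq Y         = refl
  glue-copy₂ eq (inner _) = refl

module _ {n} {S T : FareySubset n} {a m b : Bool} (κ : Colouring S a m) (μ : Colouring T m b) where
  private
    γ : FareyVertex (suc n) → Bool
    γ = glue (colour κ) (colour μ)

    agree : colour κ Y ≡ colour μ X
    agree = trans (colour-Y κ) (sym (colour-X μ))

    on₁ : ∀ v → γ (copy₁ v) ≡ colour κ v
    on₁ = glue-copy₁ (colour κ) (colour μ)

    on₂ : ∀ v → γ (copy₂ v) ≡ colour μ v
    on₂ = glue-copy₂ (colour κ) (colour μ) agree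

  -- Every edge but the new one lies within a copy, where the glued colouring restricts to the given
  -- one. The new edge stays `outside`, as its ends may get different colours.
  glueColourings : Colouring {suc n} (outside Vec.∷ (S Vec.++ T)) a b
  glueColourings = colouring γ (colour-X κ) (colour-Y μ) (λ {e} → mono e (edgeView n e))
    where
    mono : ∀ e → EdgeView n e → e ∈ (outside Vec.∷ (S Vec.++ T)) →
           γ (proj₁ (lookup (fareyEdges (suc n)) e)) ≡ γ (proj₂ (lookup (fareyEdges (suc n)) e))
    mono _ base ()
    mono _ (first i) e∈ rewrite ends-edge₁ n i =
      trans (on₁ _) (trans (monochromatic κ (∈-edge₁⁻ S T e∈)) (sym (on₁ _)))
    mono _ (second i) e∈ rewrite ends-edge₂ n i =
      trans (on₂ _) (trans (monochromatic μ (∈-edge₂⁻ S T e∈)) (sym (on₂ _)))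

  splits-edge₁ : ∀ i → Splits {Farey n} i (colour κ) → Splits {Farey (suc n)} (edge₁ n i) γ
  splits-edge₁ i split rewrite ends-edge₁ n i =
    λ eq → split (trans (sym (on₁ _)) (trans eq (on₁ _)))

  splits-edge₂ : ∀ i → Splits {Farey n} i (colour μ) → Splits {Farey (suc n)} (edge₂ n i) γ
  splits-edge₂ i split rewrite ends-edge₂ n i =
    λ eq → split (trans (sym (on₂ _)) (trans eq (on₂ _)))

module _ {n} {S T : FareySubset n} {a m b : Bool} where

  -- Deleting an edge of the first copy leaves `T` unchanged, so the second copy only has to supply
  -- a colouring that matches at the shared vertex.
  glueBridge₁ : ∀ {i} → Bridge S i a m → Colouring T m b →
                Bridge {suc n} (outside Vec.∷ (S Vec.++ T)) (edge₁ n i) a b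
  glueBridge₁ {i} (κ , split) μ =
    subst (λ U → ∃ λ (κ : Colouring {suc n} (outside Vec.∷ U) a b) → Splits {Farey (suc n)} (edge₁ n i) (colour κ))
          (sym ([]≔-++-↑ˡ S T i))
          (glueColourings κ μ , splits-edge₁ κ μ i split)

  glueBridge₂ : ∀ {i} → Colouring S a m → Bridge T i m b →
                Bridge {suc n} (outside Vec.∷ (S Vec.++ T)) (edge₂ n i) a b
  glueBridge₂ {i} κ (μ , split) =
    subst (λ U → ∃ λ (κ : Colouring {suc n} (outside Vec.∷ U) a b) → Splits {Farey (suc n)} (edge₂ n i) (colour κ))
          (sym ([]≔-++-↑ʳ S T i))
          (glueColourings κ μ , splits-edge₂ κ μ i split)

addBase : ∀ {n F a} s → Colouring {suc n} (outside Vec.∷ F) a a → Colouring {suc n} (s Vec.∷ F) a a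
addBase {n} {F} s (colouring c cX cY mono) = colouring c cX cY mono′
  where
  mono′ : Monochromatic {Farey (suc n)} (s Vec.∷ F) c
  mono′ {zero}  _          = trans cX (sym cY)
  mono′ {suc i} (there i∈) = mono (there i∈)

-- Spanning trees and forests separating X from Y

-- A form of `IsSpanningTree` by certificates that carry over to the next graph. The path is
-- required to be simple because it becomes part of a cycle when the new edge is added to two trees.
record Tree {n} (T : FareySubset n) : Set where
  field
    reach   : ∀ v → Walk (Farey n) T v X
    path    : SimplePath {Farey n} T X Y
    bridges : ∀ e → e ∈ T → ∃₂ λ a b → Bridge T e a b

-- The bridges of a forest must have X and Y on the same side, so that they
-- remain bridges once an edge joining X and Y is added.
record Forest {n} (T : FareySubset n) : Set where
  field
    reach    : ∀ v → Walk (Farey n) T v X ⊎ Walk (Farey n) T v Y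
    separate : ∀ a b → Colouring T a b
    bridges  : ∀ e → e ∈ T → ∃ λ a → Bridge T e a a

Tree⇒IsSpanningTree : ∀ {n} {T : FareySubset n} → Tree T → IsSpanningTree (Farey n) T
Tree⇒IsSpanningTree t = (λ u v → reach u ▷ reverse (reach v))
                      , bridges⇒acyclic λ e e∈ → let _ , _ , κ , split = bridges e e∈
                                                 in colour κ , monochromatic κ , split
  where open Tree t

Forest⇒¬Walk : ∀ {n} {T : FareySubset n} → Forest T → ¬ Walk (Farey n) T X Y
Forest⇒¬Walk f w
  with colouring c cX cY mono ← Forest.separate f false true
  with () ← trans (sym cX) (trans (monochromatic-walk {c = c} mono w) cY)

Forest⇒¬Tree : ∀ {n} {T : FareySubset n} → Forest T → ¬ Tree T
Forest⇒¬Tree f t = Forest⇒¬Walk f (SimplePath.walk (Tree.path t))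

Detached⇒¬Connected : ∀ {n} {T : FareySubset n} → Detached T → ¬ Connected (Farey n) T
Detached⇒¬Connected (colouring c cX _ mono , z , cz) connected
  with () ← trans (sym cX) (trans (monochromatic-walk {c = c} mono (connected X z)) cz)

separated₀ : Forest {0} (outside Vec.∷ Vec.[])
separated₀ = record
  { reach    = λ { X → inj₁ stop ; Y → inj₂ stop ; (inner ()) }
  ; separate = λ a b → colouring (λ { X → a ; Y → b ; (inner ()) }) refl refl λ { {zero} () }
  ; bridges  = λ { zero () }
  }

edge₀ : Tree {0} (inside Vec.∷ Vec.[])
edge₀ = record
  { reach   = λ { X → stop ; Y → step zero here (inj₂ refl) stop ; (inner ()) }
  ; path    = record
    { walk           = step zero here (inj₁ refl) stop
    ; uniqueEdges    = [] ∷ []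
    ; uniqueVertices = [] ∷ []
    ; end∉           = λ { (here ()) ; (there ()) }
    }
  -- Deleting the only edge leaves the subset of `separated₀`, whose colourings can tell `X` from
  -- `Y`.
  ; bridges = λ { zero _ → false , true , separate false true , λ () }
  }
  where open Forest separated₀

module _ {n} {S T : FareySubset n} where

  joinTrees : Tree S → Tree T → Tree {suc n} (outside Vec.∷ (S Vec.++ T))
  joinTrees s t = record
    { reach   = λ v → reach (copyView v)
    ; path    = proj₁ (joinPaths S T s.path t.path)
    ; bridges = λ e → bridges (edgeView n e)
    }
    where
    module s = Tree s
    module t = Tree t
    reach : ∀ {v} → CopyView v → Walk (Farey (suc n)) _ v X
    reach (first v)  = walk₁ S T (s.reach v)
    reach (second v) = walk₂ S T (t.reach v) ▷ walk₁ S T (s.reach Y)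
    bridges : ∀ {e} → EdgeView n e → e ∈ _ → ∃₂ λ a b → Bridge {suc n} _ e a b
    bridges base ()
    -- The other copy is coloured constantly with the colour of the shared vertex.
    bridges (first i)  e∈ with a , b , κ ← s.bridges i (∈-edge₁⁻ S T e∈) = a , b , glueBridge₁ κ (constant b)
    bridges (second i) e∈ with a , b , κ ← t.bridges i (∈-edge₂⁻ S T e∈) = a , b , glueBridge₂ (constant a) κ

  joinTreeForest : Tree S → Forest T → Forest {suc n} (outside Vec.∷ (S Vec.++ T))
  joinTreeForest s t = record
    { reach    = λ v → reach (copyView v)
    ; separate = λ a b → glueColourings (constant a) (t.separate a b)
    ; bridges  = λ e → bridges (edgeView n e)
    }
    where
    module s = Tree s
    module t = Forest t
    reach : ∀ {v} → CopyView v → Walk (Farey (suc n)) _ v X ⊎ Walk (Farey (suc n)) _ v Y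
    reach (first v)  = inj₁ (walk₁ S T (s.reach v))
    reach (second v) = Sum.map (λ w → walk₂ S T w ▷ walk₁ S T (s.reach Y)) (walk₂ S T) (t.reach v)
    bridges : ∀ {e} → EdgeView n e → e ∈ _ → ∃ λ a → Bridge {suc n} _ e a a
    bridges base ()
    -- The tree's certificate may colour `X` and the shared vertex differently; the forest in the
    -- second copy brings `b` back to `a` at `Y`, which gives the equal colours demanded of a
    -- forest's bridge.
    bridges (first i)  e∈ with a , b , κ ← s.bridges i (∈-edge₁⁻ S T e∈) = a , glueBridge₁ κ (t.separate b a)
    bridges (second i) e∈ with a , κ ← t.bridges i (∈-edge₂⁻ S T e∈) = a , glueBridge₂ (constant a) κ

  joinForestTree : Forest S → Tree T → Forest {suc n} (outside Vec.∷ (S Vec.++ T))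
  joinForestTree s t = record
    { reach    = λ v → reach (copyView v)
    ; separate = λ a b → glueColourings (s.separate a b) (constant b)
    ; bridges  = λ e → bridges (edgeView n e)
    }
    where
    module s = Forest s
    module t = Tree t
    mid→Y : Walk (Farey (suc n)) (outside Vec.∷ (S Vec.++ T)) (inner mid) Y
    mid→Y = reverse (walk₂ S T (t.reach Y))
    reach : ∀ {v} → CopyView v → Walk (Farey (suc n)) _ v X ⊎ Walk (Farey (suc n)) _ v Y
    reach (first v)  = Sum.map (walk₁ S T) (λ w → walk₁ S T w ▷ mid→Y) (s.reach v)
    reach (second v) = inj₂ (walk₂ S T (t.reach v) ▷ mid→Y)
    bridges : ∀ {e} → EdgeView n e → e ∈ _ → ∃ λ a → Bridge {suc n} _ e a a
    bridges base ()
    bridges (first i)  e∈ with a , κ ← s.bridges i (∈-edge₁⁻ S T e∈) = a , glueBridge₁ κ (constant a)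
    bridges (second i) e∈ with a , b , κ ← t.bridges i (∈-edge₂⁻ S T e∈) = b , glueBridge₂ (s.separate b a) κ

  -- The component of the shared vertex is coloured `true` and those of `X` and `Y` `false`, so it
  -- is cut off whether or not the new edge is present.
  joinForests : ∀ {s} → Forest S → Forest T → Detached {suc n} (s Vec.∷ (S Vec.++ T))
  joinForests {s} σ τ = addBase s (glueColourings κ (Forest.separate τ true false)) , inner mid , colour-Y κ
    where κ = Forest.separate σ false true

  detached₁ : ∀ {s} → Detached S → Detached {suc n} (s Vec.∷ (S Vec.++ T))
  detached₁ {s} (κ , z , eq) =
    addBase s (glueColourings κ (constant false)) , copy₁ z , trans (glue-copy₁ _ _ z) eq

  detached₂ : ∀ {s} → Detached T → Detached {suc n} (s Vec.∷ (S Vec.++ T))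
  detached₂ {s} (κ , z , eq) =
    addBase s (glueColourings (constant false) κ) , copy₂ z , trans (glue-copy₂ _ _ (sym (colour-X κ)) z) eq

  cyclic₁ : ∀ {s} → Cyclic {Farey n} S → Cyclic {Farey (suc n)} (s Vec.∷ (S Vec.++ T))
  cyclic₁ = Embedding.mapCyclic (embed₁ S T)

  cyclic₂ : ∀ {s} → Cyclic {Farey n} T → Cyclic {Farey (suc n)} (s Vec.∷ (S Vec.++ T))
  cyclic₂ = Embedding.mapCyclic (embed₂ S T)

  -- The new edge closes the path from `X` through the shared vertex to `Y`.
  closeTrees : Tree S → Tree T → Cyclic {Farey (suc n)} (inside Vec.∷ (S Vec.++ T))
  closeTrees s t with p , 0∉p ← joinPaths S T (Tree.path s) (Tree.path t) =
    closePath p here (inj₂ refl) 0∉p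

-- The new edge joins the two components. It is a bridge because the forest has a colouring that
-- separates its ends; the old bridges persist because their certificates give `X` and `Y` the same
-- colour.
closeForest : ∀ {n F} → Forest {suc n} (outside Vec.∷ F) → Tree {suc n} (inside Vec.∷ F)
closeForest {n} {F} f = record
  { reach   = λ v → [ weaken , (λ w → weaken w ▷ step zero here (inj₂ refl) stop) ]′ (reach v)
  ; path    = record
    { walk           = step zero here (inj₁ refl) stop
    ; uniqueEdges    = [] ∷ []
    ; uniqueVertices = [] ∷ []
    ; end∉           = λ { (here ()) ; (there ()) }
    }
  ; bridges = bridges′
  }
  where
  open Forest f
  weaken : ∀ {u v} → Walk (Farey (suc n)) (outside Vec.∷ F) u v → Walk (Farey (suc n)) (inside Vec.∷ F) u v
  weaken stop                          = stop
  weaken (step (suc e) (there e∈) j w) = step (suc e) (there e∈) j (weaken w)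
  bridges′ : ∀ e → e ∈ _ → ∃₂ λ a b → Bridge {suc n} (inside Vec.∷ F) e a b
  bridges′ zero _ = false , true , κ , λ eq → false≢true (trans (sym (colour-X κ)) (trans eq (colour-Y κ)))
    where
    κ = separate false true
    false≢true : false ≢ true
    false≢true ()
  bridges′ (suc e) (there e∈) with a , κ , split ← bridges (suc e) (there e∈) = a , a , addBase inside κ , split

-- Enumeration

pairs : ∀ {n} → List (FareySubset n) → List (FareySubset n) → List (Subset (fareySize n + fareySize n))
pairs = cartesianProductWith Vec._++_

mutual
  trees : ∀ n → List (FareySubset n)
  trees zero    = (inside Vec.∷ Vec.[]) ∷ []
  trees (suc n) = List.map (outside Vec.∷_) (pairs (trees n) (trees n))
                  List.++ List.map (inside Vec.∷_) (treeForestPairs n)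

  forests : ∀ n → List (FareySubset n)
  forests zero    = (outside Vec.∷ Vec.[]) ∷ []
  forests (suc n) = List.map (outside Vec.∷_) (treeForestPairs n)

  -- One list serves twice: with the new edge its members are trees, without it separating forests.
  treeForestPairs : ∀ n → List (Subset (fareySize n + fareySize n))
  treeForestPairs n = pairs (trees n) (forests n) List.++ pairs (forests n) (trees n)

mutual
  trees-sound : ∀ n {T} → T List∈.∈ trees n → Tree T
  trees-sound zero    (here refl) = edge₀
  trees-sound (suc n) T∈ with ∈-++⁻ (List.map (outside Vec.∷_) (pairs (trees n) (trees n))) T∈
  ... | inj₁ T∈₁ with _ , U∈ , refl ← ∈-map⁻ _ T∈₁
                 with S , T , S∈ , T∈ , refl ← ∈-cartesianProductWith⁻ Vec._++_ (trees n) (trees n) U∈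
                 = joinTrees (trees-sound n S∈) (trees-sound n T∈)
  ... | inj₂ T∈₂ with _ , U∈ , refl ← ∈-map⁻ _ T∈₂ = closeForest (treeForestPairs-sound n U∈)

  forests-sound : ∀ n {T} → T List∈.∈ forests n → Forest T
  forests-sound zero    (here refl) = separated₀
  forests-sound (suc n) T∈ with _ , U∈ , refl ← ∈-map⁻ _ T∈ = treeForestPairs-sound n U∈

  treeForestPairs-sound : ∀ n {U} → U List∈.∈ treeForestPairs n → Forest {suc n} (outside Vec.∷ U)
  treeForestPairs-sound n U∈ with ∈-++⁻ (pairs (trees n) (forests n)) U∈
  ... | inj₁ U∈₁ with S , T , S∈ , T∈ , refl ← ∈-cartesianProductWith⁻ Vec._++_ (trees n) (forests n) U∈₁
                 = joinTreeForest (trees-sound n S∈) (forests-sound n T∈)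
  ... | inj₂ U∈₂ with S , T , S∈ , T∈ , refl ← ∈-cartesianProductWith⁻ Vec._++_ (forests n) (trees n) U∈₂
                 = joinForestTree (forests-sound n S∈) (trees-sound n T∈)

-- Exhaustive classification of edge subsets

data Class {n} (T : FareySubset n) : Set where
  tree     : T List∈.∈ trees n → Class T
  forest   : T List∈.∈ forests n → Class T
  cyclic   : Cyclic {Farey n} T → Class T
  detached : Detached T → Class T

-- Cycles and detached vertices persist whatever the other copy contains. Two forests detach the
-- shared vertex, and two trees with the new edge contain a cycle. The remaining combinations are
-- exactly the enumerated ones.
classify-join : ∀ {n} s {S T : FareySubset n} → Class S → Class T → Class {suc n} (s Vec.∷ (S Vec.++ T))
classify-join s (cyclic p)   _            = cyclic (cyclic₁ p)
classify-join s (detached p) _            = detached (detached₁ p)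
classify-join s (tree _)     (cyclic q)   = cyclic (cyclic₂ q)
classify-join s (forest _)   (cyclic q)   = cyclic (cyclic₂ q)
classify-join s (tree _)     (detached q) = detached (detached₂ q)
classify-join s (forest _)   (detached q) = detached (detached₂ q)
classify-join {n} s (forest p) (forest q) = detached (joinForests (forests-sound n p) (forests-sound n q))
classify-join {n} false (tree p) (tree q) =
  tree (∈-++⁺ˡ (∈-map⁺ _ (∈-cartesianProductWith⁺ Vec._++_ p q)))
classify-join {n} true (tree p) (tree q) = cyclic (closeTrees (trees-sound n p) (trees-sound n q))
classify-join {n} false (tree p) (forest q) =
  forest (∈-map⁺ _ (∈-++⁺ˡ (∈-cartesianProductWith⁺ Vec._++_ p q)))
classify-join {n} false (forest p) (tree q) =
  forest (∈-map⁺ _ (∈-++⁺ʳ (pairs (trees n) (forests n)) (∈-cartesianProductWith⁺ Vec._++_ p q)))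
classify-join {n} true (tree p) (forest q) =
  tree (∈-++⁺ʳ (List.map (outside Vec.∷_) (pairs (trees n) (trees n)))
         (∈-map⁺ _ (∈-++⁺ˡ (∈-cartesianProductWith⁺ Vec._++_ p q))))
classify-join {n} true (forest p) (tree q) =
  tree (∈-++⁺ʳ (List.map (outside Vec.∷_) (pairs (trees n) (trees n)))
         (∈-map⁺ _ (∈-++⁺ʳ (pairs (trees n) (forests n)) (∈-cartesianProductWith⁺ Vec._++_ p q))))

classify : ∀ n (T : FareySubset n) → Class T
classify zero    (false Vec.∷ Vec.[]) = forest (here refl)
classify zero    (true  Vec.∷ Vec.[]) = tree (here refl)
classify (suc n) (s Vec.∷ U) with S , T , refl ← Vec.splitAt (fareySize n) U =
  classify-join s (classify n S) (classify n T)

-- By elimination: each of the other three classes contradicts connectedness or acyclicity.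
trees-complete : ∀ n {T} → IsSpanningTree (Farey n) T → T List∈.∈ trees n
trees-complete n {T} (connected , acyclic) with classify n T
... | tree T∈            = T∈
... | forest T∈          = ⊥-elim (Forest⇒¬Walk (forests-sound n T∈) (connected X Y))
... | cyclic (_ , w , p) = ⊥-elim (acyclic w p)
... | detached d         = ⊥-elim (Detached⇒¬Connected d connected)

-- The enumeration has no repetitions

pairs-unique : ∀ {n} {xs ys : List (FareySubset n)} → Unique xs → Unique ys → Unique (pairs {n} xs ys)
pairs-unique = Unique.cartesianProductWith⁺ Vec._++_ (++-injective _ _)

mutual
  trees-unique : ∀ n → Unique (trees n)
  trees-unique zero    = [] ∷ []
  trees-unique (suc n) =
    Unique.++⁺ (Unique.map⁺ ∷-injectiveʳ (pairs-unique (trees-unique n) (trees-unique n)))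
               (Unique.map⁺ ∷-injectiveʳ (treeForestPairs-unique n))
               λ (p , q) → differ (proj₂ (proj₂ (∈-map⁻ _ p))) (proj₂ (proj₂ (∈-map⁻ _ q)))
    where
    differ : ∀ {m} {V W : Subset m} {T} → T ≡ outside Vec.∷ V → ¬ T ≡ inside Vec.∷ W
    differ refl ()

  forests-unique : ∀ n → Unique (forests n)
  forests-unique zero    = [] ∷ []
  forests-unique (suc n) = Unique.map⁺ ∷-injectiveʳ (treeForestPairs-unique n)

  treeForestPairs-unique : ∀ n → Unique (treeForestPairs n)
  treeForestPairs-unique n =
    Unique.++⁺ (pairs-unique (trees-unique n) (forests-unique n))
               (pairs-unique (forests-unique n) (trees-unique n))
               λ (p , q) → disjoint (∈-cartesianProductWith⁻ Vec._++_ (trees n) (forests n) p)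
                                    (∈-cartesianProductWith⁻ Vec._++_ (forests n) (trees n) q)
    where
    disjoint : ∀ {U} → (∃₂ λ S T → S List∈.∈ trees n × T List∈.∈ forests n × U ≡ S Vec.++ T) →
               ¬ (∃₂ λ S T → S List∈.∈ forests n × T List∈.∈ trees n × U ≡ S Vec.++ T)
    -- Since `U` splits uniquely, its part in the first copy would be both a tree and a separating
    -- forest.
    disjoint (S , _ , S∈ , _ , refl) (S′ , _ , S′∈ , _ , eq) with refl ← proj₁ (++-injective S S′ eq) =
      Forest⇒¬Tree (forests-sound n S′∈) (trees-sound n S∈)

-- Counting

length-cartesianProductWith : ∀ {A B C : Set} (f : A → B → C) xs ys →
  length (cartesianProductWith f xs ys) ≡ length xs * length ys
length-cartesianProductWith f []       ys = refl
length-cartesianProductWith f (x ∷ xs) ys =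
  trans (length-++ (List.map (f x) ys))
        (cong₂ _+_ (length-map (f x) ys) (length-cartesianProductWith f xs ys))

length-treeForestPairs : ∀ n →
  length (treeForestPairs n) ≡ length (trees n) * length (forests n) + length (forests n) * length (trees n)
length-treeForestPairs n =
  trans (length-++ (pairs (trees n) (forests n)))
        (cong₂ _+_ (length-cartesianProductWith _ (trees n) (forests n))
                   (length-cartesianProductWith _ (forests n) (trees n)))

length-forests-suc : ∀ n →
  length (forests (suc n)) ≡ length (trees n) * length (forests n) + length (forests n) * length (trees n)
length-forests-suc n = trans (length-map _ (treeForestPairs n)) (length-treeForestPairs n)

length-trees-suc : ∀ n →
  length (trees (suc n)) ≡ length (trees n) * length (trees n) + length (forests (suc n))
length-trees-suc n =
  trans (length-++ (List.map (outside Vec.∷_) (pairs (trees n) (trees n))))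
        (cong₂ _+_ (trans (length-map _ (pairs (trees n) (trees n)))
                          (length-cartesianProductWith _ (trees n) (trees n)))
                   (trans (length-map _ (treeForestPairs n)) (sym (length-map _ (treeForestPairs n)))))

-- Recurrence for the product and closed forms

product-applyUpTo-square : ∀ (f g : ℕ → ℕ) k → (∀ {j} → j < k → g j ≡ f j * f j) →
  product (applyUpTo g k) ≡ product (applyUpTo f k) * product (applyUpTo f k)
product-applyUpTo-square f g zero    eq = refl
product-applyUpTo-square f g (suc k) eq
  rewrite eq {0} (s≤s z≤n)
        | product-applyUpTo-square (f ∘ suc) (g ∘ suc) k (λ j<k → eq (s≤s j<k)) =
  interchange (f 0) (product (applyUpTo (f ∘ suc) k))
  where
  interchange : ∀ x p → x * x * (p * p) ≡ x * p * (x * p)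
  interchange = solve-∀

product-applyUpTo-suc : ∀ (f : ℕ → ℕ) k → product (applyUpTo f (suc k)) ≡ product (applyUpTo f k) * f k
product-applyUpTo-suc f k = begin
  product (applyUpTo f (suc k))                ≡⟨ cong product (applyUpTo-∷ʳ f k) ⟨
  product (applyUpTo f k List.++ f k ∷ [])     ≡⟨ product-++ (applyUpTo f k) _ ⟩
  product (applyUpTo f k) * (f k * 1)          ≡⟨ cong (product (applyUpTo f k) *_) (*-identityʳ (f k)) ⟩
  product (applyUpTo f k) * f k                ∎
  where open ≡-Reasoning

mersenneProduct : ℕ → ℕ
mersenneProduct n = ∏ 2 n (λ i → (2 ^ i ∸ 1) ^ (2 ^ (n ∸ i)))

-- Passing from `n` to `suc n` doubles every exponent, which squares the product, and adds the
-- factor for i = n + 1 with exponent 2^0 = 1.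
mersenneProduct-suc : ∀ n →
  mersenneProduct (suc n) ≡ mersenneProduct n * mersenneProduct n * (2 ^ suc n ∸ 1)
-- Both products are empty, and the extra factor `2 ^ 1 ∸ 1` is 1.
mersenneProduct-suc zero    = refl
mersenneProduct-suc (suc k) =
  trans (product-applyUpTo-suc g k)
        (cong₂ _*_ (product-applyUpTo-square f g k square) last)
  where
  f g : ℕ → ℕ
  f j = (2 ^ (2 + j) ∸ 1) ^ (2 ^ (suc k ∸ (2 + j)))
  g j = (2 ^ (2 + j) ∸ 1) ^ (2 ^ (suc (suc k) ∸ (2 + j)))

  square : ∀ {j} → j < k → g j ≡ f j * f j
  -- Because `j < k`, the truncated subtraction is exact and the exponent in `g` is twice that in
  -- `f`.
  square {j} j<k rewrite +-∸-assoc 1 j<k | +-identityʳ (2 ^ (k ∸ suc j)) =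
    ^-distribˡ-+-* (2 ^ (2 + j) ∸ 1) (2 ^ (k ∸ suc j)) (2 ^ (k ∸ suc j))

  last : g k ≡ 2 ^ (2 + k) ∸ 1
  last rewrite n∸n≡0 k = *-identityʳ _

-- The summand `2 ^ suc n` appears as `2 * 2 ^ n` to match the forest factor `2 ^ n` in the
-- recurrence for trees.
mersenne-suc : ∀ n → 2 ^ suc (suc n) ∸ 1 ≡ (2 ^ suc n ∸ 1) + 2 * 2 ^ n
mersenne-suc n = begin
  2 ^ suc n + (2 ^ suc n + 0) ∸ 1  ≡⟨ cong (λ x → 2 ^ suc n + x ∸ 1) (+-identityʳ (2 ^ suc n)) ⟩
  2 ^ suc n + 2 ^ suc n ∸ 1        ≡⟨ +-∸-assoc (2 ^ suc n) (m^n>0 2 (suc n)) ⟩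
  2 ^ suc n + (2 ^ suc n ∸ 1)      ≡⟨ +-comm (2 ^ suc n) _ ⟩
  (2 ^ suc n ∸ 1) + 2 * 2 ^ n      ∎
  where open ≡-Reasoning

-- With t = mp and f = qp, where m = 2^(n+1) - 1 and q = 2^n, the recurrences give f' = 2q(p²m) and
-- t' = (m + 2q)(p²m). Here p²m is the next product and m + 2q the next Mersenne number.
length-trees-forests : ∀ n →
  length (trees n) ≡ (2 ^ suc n ∸ 1) * mersenneProduct n × length (forests n) ≡ 2 ^ n * mersenneProduct n
length-trees-forests zero    = refl , refl
length-trees-forests (suc n) with t , f ← length-trees-forests n = treeCount , forestCount
  where
  M = 2 ^ suc n ∸ 1
  P = mersenneProduct n

  forestCount : length (forests (suc n)) ≡ 2 ^ suc n * mersenneProduct (suc n)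
  forestCount rewrite length-forests-suc n | t | f | mersenneProduct-suc n = identity M (2 ^ n) P
    where
    identity : ∀ m q p → m * p * (q * p) + q * p * (m * p) ≡ 2 * q * (p * p * m)
    identity = solve-∀

  treeCount : length (trees (suc n)) ≡ (2 ^ suc (suc n) ∸ 1) * mersenneProduct (suc n)
  treeCount rewrite length-trees-suc n | forestCount | t | mersenne-suc n | mersenneProduct-suc n =
    identity M (2 ^ n) P
    where
    identity : ∀ m q p → m * p * (m * p) + 2 * q * (p * p * m) ≡ (m + 2 * q) * (p * p * m)
    identity = solve-∀

mainTheorem3 : ∀ (n : ℕ) → NumSpanningTrees (Farey n) ((2 ^ (n + 1) ∸ 1) * ∏ 2 n (λ i → (2 ^ i ∸ 1) ^ (2 ^ (n ∸ i))))
mainTheorem3 n =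
    trees n
  , trees-unique n
  , (λ T → mk⇔ (Tree⇒IsSpanningTree ∘ trees-sound n) (trees-complete n))
  , trans (proj₁ (length-trees-forests n)) (cong (λ k → (2 ^ k ∸ 1) * mersenneProduct n) (+-comm 1 n))
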